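{- Let $m, n$ be positive even integers and let $k$ be an integer with $k \geq (-1)^{n-1} f_{n-2}(m) + 1$. Put $$s = (-1)^n f_n(m) f_{n-1}(m) + k f_{n+1}(m), \quad t = (-1)^{n-1} f_{n-1}(m)^2 - k f_n(m), \quad \beta(n,m,k) = \sqrt{s^2 - 4t}.$$ Let $\mathbf v(m) = (\frac{m}{2}, 2m, \frac{m}{2}, 2m, \ldots, \frac{m}{2}, 2m)$ be the finite sequence of length $n$ alternating $\frac m2$ and $2m$ (starting with $\frac m2$), let $\mathbf v(m)^R$ be $\mathbf v(m)$ reversed, and let $\mathbf u(m) = (1, 1, \frac{m-2}{2}, 1, 1, \frac{m-2}{2}, \ldots, 1, 1, \frac{m-2}{2})$ be the sequence of length $3n$ obtained by repeating the block $(1,1,\frac{m-2}{2})$ $n$ times. Then: (1) if $k$ is even, $\beta(n,m,k) = [s; \overline{\mathbf v(m), \frac{s}{2}, \mathbf v(m)^R, 2s}]$; (2) if $k$ is odd and $m > 2$, $\beta(n,m,k) = [s; \overline{\mathbf v(m), \frac{s-1}{2}, \mathbf u(m), 1, 1, \frac{s-1}{2}, \mathbf v(m)^R, 2s}]$; (3) if $k$ is odd and $m = 2$, $\beta(n,2,k) = [s; \overline{\mathbf v(2), \frac{s-1}{2}, 1, \mathbf 2, 1, \frac{s-1}{2}, \mathbf v(2)^R, 2s}]$, where $\mathbf 2$ denotes the sequence of length $n$ all of whose terms equal $2$.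
   Context: The Fibonacci polynomials $f_h(m)$, for a fixed integer $m$, are defined by $f_0(m) = 0$, $f_1(m) = 1$, $f_h(m) = m f_{h-1}(m) + f_{h-2}(m)$ for $h \geq 2$, and $f_{ -h}(m) = (-1)^{h-1} f_h(m)$ for $h \geq 1$. $[b_0; b_1, b_2, \ldots]$ denotes a simple continued fraction, and an overline denotes the periodically repeated block (sequences inside it are concatenated). -}

module Defs where

open import Data.Nat as ℕ using (ℕ; zero; suc)
import Data.Nat.DivMod as ℕD
open import Data.Integer using (ℤ; +_; _+_; _*_; _-_; -_; _<_; _≤_; 0ℤ; 1ℤ)
open import Data.Integer.DivMod using (_/ℕ_)
open import Data.List using (List; []; _∷_; _++_; reverse; length; [_])
open import Data.Product using (_×_; ∃)
open import Data.Sum using (_⊎_)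
open import Relation.Binary.PropositionalEquality using (_≡_)

-- Fibonacci polynomials f_h(m) for h ≥ 0 (only nonnegative indices occur)
fib : ℤ → ℕ → ℤ
fib m zero = 0ℤ
fib m (suc zero) = 1ℤ
fib m (suc (suc h)) = m * fib m (suc h) + fib m h

sgn : ℕ → ℤ
sgn zero = 1ℤ
sgn (suc h) = - sgn h

EvenZ : ℤ → Set
EvenZ k = ∃ λ j → k ≡ + 2 * j

OddZ : ℤ → Set
OddZ k = ∃ λ j → k ≡ + 2 * j + 1ℤ

rep : {A : Set} → ℕ → List A → List A
rep zero xs = []
rep (suc j) xs = xs ++ rep j xs

nth : ℤ → List ℤ → ℕ → ℤ
nth d [] _ = d
nth d (x ∷ xs) zero = x
nth d (x ∷ xs) (suc i) = nth d xs i

-- the infinite sequence [a0; overline(per)] : index 0 ↦ a0,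
-- index i+1 ↦ per[i mod |per|]  (per is always nonempty below)
periodicCF : ℤ → List ℤ → ℕ → ℤ
periodicCF a0 per zero = a0
periodicCF a0 per (suc i) = nth 0ℤ per (i ℕD.% suc (ℕ.pred (length per)))

P : (ℕ → ℤ) → ℕ → ℤ
P a zero = a 0
P a (suc zero) = a 1 * a 0 + 1ℤ
P a (suc (suc n)) = a (suc (suc n)) * P a (suc n) + P a n

Q : (ℕ → ℤ) → ℕ → ℤ
Q a zero = 1ℤ
Q a (suc zero) = a 1
Q a (suc (suc n)) = a (suc (suc n)) * Q a (suc n) + Q a n

-- for q > 0 :  p/q < √D
BelowSqrt : ℤ → ℤ → ℤ → Set
BelowSqrt D p q = p < 0ℤ ⊎ p * p < D * (q * q)

-- for q > 0 :  √D < p/q   (and D ≥ 0 so √D is real)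
AboveSqrt : ℤ → ℤ → ℤ → Set
AboveSqrt D p q = 0ℤ ≤ D × 0ℤ ≤ p × D * (q * q) < p * p

-- √D = [a0; a1, a2, ...] (an infinite simple continued fraction):
-- a_i ≥ 1 for i ≥ 1, and √D is the limit of the convergents p_n/q_n.
-- For an infinite simple continued fraction the convergents of even index
-- increase and those of odd index decrease to the value, and the interval
-- lengths tend to 0; hence "value = √D" is exactly that √D lies strictly
-- above every even convergent and strictly below every odd one.
SqrtCF : ℤ → (ℕ → ℤ) → Set
SqrtCF D a =
  (∀ i → 1ℤ ≤ a (suc i)) ×
  (∀ n → BelowSqrt D (P a (2 ℕ.* n)) (Q a (2 ℕ.* n))
       × AboveSqrt D (P a (suc (2 ℕ.* n))) (Q a (suc (2 ℕ.* n))))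

module _ (m n : ℕ) (k : ℤ) where
  fm : ℕ → ℤ
  fm = fib (+ m)

  sS : ℤ
  sS = sgn n * fm n * fm (n ℕ.∸ 1) + k * fm (suc n)

  tT : ℤ
  tT = sgn (n ℕ.∸ 1) * (fm (n ℕ.∸ 1) * fm (n ℕ.∸ 1)) - k * fm n

  DD : ℤ
  DD = sS * sS - + 4 * tT

  vv : List ℤ
  vv = rep (n ℕD./ 2) (+ (m ℕD./ 2) ∷ + (2 ℕ.* m) ∷ [])

  uu : List ℤ
  uu = rep n (1ℤ ∷ 1ℤ ∷ + ((m ℕ.∸ 2) ℕD./ 2) ∷ [])

  twos : List ℤ
  twos = rep n [ + 2 ]

  period1 : List ℤ
  period1 = vv ++ [ sS /ℕ 2 ] ++ reverse vv ++ [ + 2 * sS ]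

  period2 : List ℤ
  period2 = vv ++ [ (sS - 1ℤ) /ℕ 2 ] ++ uu ++ (1ℤ ∷ 1ℤ ∷ (sS - 1ℤ) /ℕ 2 ∷ [])
            ++ reverse vv ++ [ + 2 * sS ]

  period3 : List ℤ
  period3 = vv ++ [ (sS - 1ℤ) /ℕ 2 ] ++ [ 1ℤ ] ++ twos ++ (1ℤ ∷ (sS - 1ℤ) /ℕ 2 ∷ [])
            ++ reverse vv ++ [ + 2 * sS ]

{-# OPTIONS --safe #-}
module Submission where

-- The convergents X/Y of [s; ...] approach √D from alternating sides iff the norms
-- X² − D Y² alternate in sign, and the absolute values of these norms evolve by a map
-- that depends only on the next partial quotient.  It therefore suffices that this map
-- sends the initial state (4|t|, s, 1) back to itself along the period, staying positive.
-- Put κ = k + f_{n−2} ≥ 1.  By Cassini's identity s = κ f_{n+1} + m and −t = κ f_n + 1,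
-- and all states along 𝐯, 𝐮 and 𝟐 are explicit in terms of x_j = κ f_j f_{n+1−j} + 1, which
-- makes positivity evident.  A step commutes with swapping its two ends, so reversing a word
-- reverses its run, which gives the second half of the period for free.

open import Defs
open import Data.Nat using (ℕ; zero; suc; _∸_)
open import Data.Nat.Divisibility using (_∣_; divides)
open import Data.Integer using (ℤ; +_; +[1+_]; _+_; _*_; _-_; -_; _≤_; _<_; +≤+; +<+; 0ℤ; 1ℤ)
import Data.Nat as N
import Data.Nat.DivMod as ND
import Data.Nat.Properties as NP
open import Data.Integer.DivMod using (_/ℕ_)
import Data.Integer.Properties as ZP
open import Data.Integer.Tactic.RingSolver using (solve-∀)
open import Data.List using (List; []; _∷_; _++_; reverse; length; [_])
open import Data.List.Properties using (unfold-reverse; ++-conicalʳ; ++-assoc; ++-identityʳ; length-++)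
open import Data.Product using (_×_; _,_; proj₁; proj₂; ∃)
open import Data.Sum using (inj₂)
open import Data.Empty using (⊥-elim)
open import Relation.Binary.PropositionalEquality using (_≡_; _≢_; refl; sym; trans; cong; cong₂; subst; subst₂)

-- Signs of sums and products of integers.

0≤+ : ∀ {a b} → 0ℤ ≤ a → 0ℤ ≤ b → 0ℤ ≤ a + b
0≤+ = ZP.+-mono-≤

0≤+< : ∀ {a b} → 0ℤ ≤ a → 0ℤ < b → 0ℤ < a + b
0≤+< = ZP.+-mono-≤-<

0≤* : ∀ {a b} → 0ℤ ≤ a → 0ℤ ≤ b → 0ℤ ≤ a * b
0≤* {+ a} {+ b} _ _ = subst (0ℤ ≤_) (ZP.pos-* a b) (+≤+ N.z≤n)

0<* : ∀ {a b} → 0ℤ < a → 0ℤ < b → 0ℤ < a * b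
0<* {+[1+ a ]} {+[1+ b ]} _ _ = +<+ (N.s≤s N.z≤n)
0<* {+ zero} (+<+ ())
0<* {+[1+ a ]} {+ zero} _ (+<+ ())

0<pos : ∀ {n} → 0ℤ < +[1+ n ]
0<pos = +<+ (N.s≤s N.z≤n)

1≤pos : ∀ {n} → 1ℤ ≤ +[1+ n ]
1≤pos = +≤+ (N.s≤s N.z≤n)

1≤⇒0≤ : ∀ {a} → 1ℤ ≤ a → 0ℤ ≤ a
1≤⇒0≤ = ZP.≤-trans (+≤+ N.z≤n)

1≤⇒0< : ∀ {a} → 1ℤ ≤ a → 0ℤ < a
1≤⇒0< = ZP.<-≤-trans 0<pos

0<⇒1≤ : ∀ {a} → 0ℤ < a → 1ℤ ≤ a
0<⇒1≤ = ZP.i<j⇒suc[i]≤j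

-- The norm recurrence and its reversal symmetry.

-- Up to alternating signs, (u , p , w) are X² − D Y², X X′ − D Y Y′ and X′² − D Y′² for
-- consecutive convergents X′/Y′, X/Y of √D; `next a` appends the partial quotient a.
State : Set
State = ℤ × ℤ × ℤ

next : ℤ → State → State
next a (u , p , w) = + 2 * p * a + w - u * (a * a) , a * u - p , u

swap : State → State
swap (u , p , w) = w , p , u

-- Positivity is asked of the last entry of the source and the first of the target, the two that
-- reversal exchanges, so the record is symmetric under `swap`.
record Step (a : ℤ) (S T : State) : Set where
  constructor step
  field
    quotient≥1 : 1ℤ ≤ a
    source>0   : 0ℤ < proj₂ (proj₂ S)
    target>0   : 0ℤ < proj₁ T
    next≡      : next a S ≡ T

data Run : State → List ℤ → State → Set where
  []  : ∀ {S} → Run S [] S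
  _∷_ : ∀ {S a T as U} → Step a S T → Run T as U → Run S (a ∷ as) U

state≡ : ∀ {u p w u′ p′ w′ : ℤ} → u ≡ u′ → p ≡ p′ → w ≡ w′ → (u , p , w) ≡ (u′ , p′ , w′)
state≡ refl refl refl = refl

infixr 5 _++ᴿ_
_++ᴿ_ : ∀ {S as T bs U} → Run S as T → Run T bs U → Run S (as ++ bs) U
[] ++ᴿ r = r
(s ∷ q) ++ᴿ r = s ∷ (q ++ᴿ r)

-- For T = (u′, p′, u) the step says p + p′ = a u and u′ - w = a (p - p′); both relations survive
-- exchanging p with p′ and w with u′.
step-swap : ∀ {a S T} → Step a S T → Step a (swap T) (swap S)
step-swap {a} {u , p , w} (step 1≤a 0<w 0<u refl) =
  step 1≤a 0<u 0<w (state≡ (first a u p w) (second a u p) refl)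
  where
  first : ∀ a u p w → + 2 * (a * u - p) * a + (+ 2 * p * a + w - u * (a * a)) - u * (a * a) ≡ w
  first = solve-∀
  second : ∀ a u p → a * u - (a * u - p) ≡ p
  second = solve-∀

run-reverse : ∀ {S as T} → Run S as T → Run (swap T) (reverse as) (swap S)
run-reverse [] = []
run-reverse {as = a ∷ as} (s ∷ r) =
  subst (λ l → Run _ l _) (sym (unfold-reverse a as)) (run-reverse r ++ᴿ step-swap s ∷ [])

-- Norms of convergents and their signs.

-- P and Q shifted by one, with the conventional values P₋₁ = 1 and Q₋₁ = 0 at the start.
prevP prevQ : (ℕ → ℤ) → ℕ → ℤ
prevP a zero = 1ℤ
prevP a (suc i) = P a i
prevQ a zero = 0ℤ
prevQ a (suc i) = Q a i

P-suc : ∀ a i → P a (suc i) ≡ a (suc i) * P a i + prevP a i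
P-suc a zero = refl
P-suc a (suc i) = refl

Q-suc : ∀ a i → Q a (suc i) ≡ a (suc i) * Q a i + prevQ a i
Q-suc a zero = lemma (a 1)
  where
  lemma : ∀ x → x ≡ x * 1ℤ + 0ℤ
  lemma = solve-∀
Q-suc a (suc i) = refl

sgn-even : ∀ n → sgn (n N.* 2) ≡ 1ℤ
sgn-even zero = refl
sgn-even (suc n) = trans (ZP.neg-involutive _) (sgn-even n)

record NormsAt (D X X′ Y Y′ σ : ℤ) (S : State) : Set where
  constructor norms
  field
    current  : X * X - D * (Y * Y) ≡ - (σ * proj₁ S)
    mixed    : X * X′ - D * (Y * Y′) ≡ σ * proj₁ (proj₂ S)
    previous : X′ * X′ - D * (Y′ * Y′) ≡ σ * proj₂ (proj₂ S)

Norms : ℤ → (ℕ → ℤ) → ℕ → State → Set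
Norms D a i = NormsAt D (P a i) (prevP a i) (Q a i) (prevQ a i) (sgn i)

-- The bilinear form X X′ - D Y Y′ is expanded at a (X, Y) + (X′, Y′), the old norms are inserted,
-- and the sign is pulled out.
norms-step : ∀ {D} a i {S} → Norms D a i S → Norms D a (suc i) (next (a (suc i)) S)
norms-step {D} a i {u , p , w} (norms cur mix prev) =
  subst₂ (λ X Y → NormsAt D X (P a i) Y (Q a i) (- sgn i) (next c (u , p , w))) (sym (P-suc a i)) (sym (Q-suc a i))
    (norms
      (trans (expand² D c (P a i) (prevP a i) (Q a i) (prevQ a i))
        (trans (cong₂ _+_ (cong₂ _+_ (cong (c * c *_) cur) (cong (+ 2 * c *_) mix)) prev)
          (collect² c (sgn i) u p w)))
      (trans (expand¹ D c (P a i) (prevP a i) (Q a i) (prevQ a i))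
        (trans (cong₂ _+_ (cong (c *_) cur) mix) (collect¹ c (sgn i) u p)))
      (trans cur (collect⁰ (sgn i) u)))
  where
  c = a (suc i)
  expand² : ∀ D a X X′ Y Y′ →
    (a * X + X′) * (a * X + X′) - D * ((a * Y + Y′) * (a * Y + Y′))
    ≡ a * a * (X * X - D * (Y * Y)) + + 2 * a * (X * X′ - D * (Y * Y′)) + (X′ * X′ - D * (Y′ * Y′))
  expand² = solve-∀
  collect² : ∀ a σ u p w → a * a * - (σ * u) + + 2 * a * (σ * p) + σ * w
    ≡ - (- σ * (+ 2 * p * a + w - u * (a * a)))
  collect² = solve-∀
  expand¹ : ∀ D a X X′ Y Y′ →
    (a * X + X′) * X - D * ((a * Y + Y′) * Y) ≡ a * (X * X - D * (Y * Y)) + (X * X′ - D * (Y * Y′))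
  expand¹ = solve-∀
  collect¹ : ∀ a σ u p → a * - (σ * u) + σ * p ≡ - σ * (a * u - p)
  collect¹ = solve-∀
  collect⁰ : ∀ σ u → - (σ * u) ≡ - σ * u
  collect⁰ = solve-∀

P-nonneg : ∀ a → 0ℤ ≤ a 0 → (∀ i → 1ℤ ≤ a (suc i)) → ∀ i → 0ℤ ≤ prevP a i × 0ℤ ≤ P a i
P-nonneg a 0≤a₀ 1≤a zero = +≤+ N.z≤n , 0≤a₀
P-nonneg a 0≤a₀ 1≤a (suc i) with P-nonneg a 0≤a₀ 1≤a i
... | 0≤P′ , 0≤P = 0≤P , subst (0ℤ ≤_) (sym (P-suc a i)) (0≤+ (0≤* (1≤⇒0≤ (1≤a i)) 0≤P) 0≤P′)

-- A positive first entry of the state makes X² - D Y² negative at even and positive at odd indices;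
-- comparison from above also needs X ≥ 0.
sqrtCF-from-norms : ∀ {D a} → 0ℤ ≤ D → 0ℤ ≤ a 0 → (∀ i → 1ℤ ≤ a (suc i)) →
  (∀ i → ∃ λ S → Norms D a i S × 0ℤ < proj₁ S) → SqrtCF D a
sqrtCF-from-norms {D} {a} 0≤D 0≤a₀ 1≤a trace = 1≤a , λ n → below n , above n
  where
  sgn-2* : ∀ n → sgn (2 N.* n) ≡ 1ℤ
  sgn-2* n = trans (cong sgn (NP.*-comm 2 n)) (sgn-even n)
  move₁ : ∀ {x y u} → x - y ≡ - (1ℤ * u) → u + x ≡ y
  move₁ {x} {y} {u} eq = trans (r₁ x y u) (trans (cong (λ z → z + y + u) eq) (r₂ y u))
    where
    r₁ : ∀ x y u → u + x ≡ (x - y) + y + u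
    r₁ = solve-∀
    r₂ : ∀ y u → - (1ℤ * u) + y + u ≡ y
    r₂ = solve-∀
  move₂ : ∀ {x y u} → x - y ≡ - (- 1ℤ * u) → u + y ≡ x
  move₂ {x} {y} {u} eq = trans (r₁ y u) (trans (cong (_+ y) (sym eq)) (r₂ x y))
    where
    r₁ : ∀ y u → u + y ≡ - (- 1ℤ * u) + y
    r₁ = solve-∀
    r₂ : ∀ x y → x - y + y ≡ x
    r₂ = solve-∀
  gap : ∀ {x y u} → 0ℤ < u → u + x ≡ y → x < y
  gap {x} {u = u} 0<u refl = subst (_< u + x) (ZP.+-identityˡ x) (ZP.+-monoˡ-< x 0<u)
  below : ∀ n → BelowSqrt D (P a (2 N.* n)) (Q a (2 N.* n))
  below n with trace (2 N.* n)
  ... | S , norms cur _ _ , 0<u = inj₂ (gap 0<u (move₁ (trans cur (cong (λ σ → - (σ * proj₁ S)) (sgn-2* n)))))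
  above : ∀ n → AboveSqrt D (P a (suc (2 N.* n))) (Q a (suc (2 N.* n)))
  above n with trace (suc (2 N.* n))
  ... | S , norms cur _ _ , 0<u = 0≤D , proj₂ (P-nonneg a 0≤a₀ 1≤a (suc (2 N.* n))) ,
    gap 0<u (move₂ (trans cur (cong (λ σ → - (- σ * proj₁ S)) (sgn-2* n))))

-- From a closed run to a periodic continued fraction.

nth-++ : ∀ (d : ℤ) xs {x ys} → nth d (xs ++ x ∷ ys) (length xs) ≡ x
nth-++ d [] = refl
nth-++ d (y ∷ xs) = nth-++ d xs

module Periodic {s u : ℤ} (y : ℤ) (ys : List ℤ) (0≤s : 0ℤ ≤ s) (0<u : 0ℤ < u)
  (loop : Run (u , s , 1ℤ) (y ∷ ys) (u , s , 1ℤ)) where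

  start : State
  start = u , s , 1ℤ

  period : List ℤ
  period = y ∷ ys

  a : ℕ → ℤ
  a = periodicCF s period

  -- An index is recorded as completed rounds plus a cut of the period; the stored remaining run
  -- supplies the positivity facts for the next step.
  record Position (i : ℕ) : Set where
    constructor position
    field
      {before after} : List ℤ
      {state}  : State
      rounds   : ℕ
      index    : i ≡ length before N.+ rounds N.* length period
      split    : period ≡ before ++ after
      norm     : Norms (s * s + u) a i state
      state>0  : 0ℤ < proj₁ state
      rest     : Run state after start

  private
    advance : ∀ {i b bs cs S} r → i ≡ length bs N.+ r N.* length period → period ≡ bs ++ b ∷ cs →
      Norms (s * s + u) a i S → Run S (b ∷ cs) start → 1ℤ ≤ a (suc i) × Position (suc i)
    advance {i} {b} {bs} {cs} {S} r idx spl nrm (step 1≤b 0<w 0<u′ refl ∷ run) =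
      subst (1ℤ ≤_) (sym a≡b) 1≤b ,
      position {before = bs ++ [ b ]} r idx′ (trans spl (sym (++-assoc bs [ b ] cs)))
        (subst (λ q → Norms _ a (suc i) (next q S)) a≡b (norms-step a i nrm)) 0<u′ run
      where
      bs<period : length bs N.< length period
      bs<period = subst (length bs N.<_) (sym (trans (cong length spl) (length-++ bs)))
                    (NP.m<m+n (length bs) (N.s≤s N.z≤n))
      i%≡ : i ND.% length period ≡ length bs
      i%≡ = trans (cong (ND._% length period) idx)
              (trans (ND.[m+kn]%n≡m%n (length bs) r (length period)) (ND.m<n⇒m%n≡m bs<period))
      -- The term before the period shifts indices by one: `a (suc i)` is entry i modulo the period
      -- length.
      a≡b : a (suc i) ≡ b
      a≡b = trans (cong₂ (nth 0ℤ) spl i%≡) (nth-++ 0ℤ bs)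
      idx′ : suc i ≡ length (bs ++ [ b ]) N.+ r N.* length period
      idx′ = trans (cong suc idx)
               (cong (N._+ r N.* length period) (sym (trans (length-++ bs) (NP.+-comm (length bs) 1))))

  move : ∀ {i} → Position i → 1ℤ ≤ a (suc i) × Position (suc i)
  move (position {after = b ∷ cs} r idx spl nrm _ run) = advance r idx spl nrm run
  -- With nothing left to read, the state is `start` again; the finished period is counted as one
  -- more round and `loop` is restarted.
  move (position {before} {[]} r idx spl nrm _ []) = advance {bs = []} (suc r)
    (trans idx (cong (λ l → length l N.+ r N.* length period) (trans (sym (++-identityʳ before)) (sym spl))))
    refl nrm loop

  positions : ∀ i → Position i
  positions zero = position {before = []} 0 refl refl (norms (n₁ s u) (n₂ s u) (n₃ s u)) 0<u loop
    where
    n₁ : ∀ s u → s * s - (s * s + u) * (1ℤ * 1ℤ) ≡ - (1ℤ * u)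
    n₁ = solve-∀
    n₂ : ∀ s u → s * 1ℤ - (s * s + u) * (1ℤ * 0ℤ) ≡ 1ℤ * s
    n₂ = solve-∀
    n₃ : ∀ s u → 1ℤ * 1ℤ - (s * s + u) * (0ℤ * 0ℤ) ≡ 1ℤ * 1ℤ
    n₃ = solve-∀
  positions (suc i) = proj₂ (move (positions i))

  sqrtCF : SqrtCF (s * s + u) a
  sqrtCF = sqrtCF-from-norms (0≤+ (0≤* 0≤s 0≤s) (ZP.<⇒≤ 0<u)) 0≤s (λ i → proj₁ (move (positions i)))
    (λ i → let open Position (positions i) in state , norm , state>0)

sqrtCF-of-loop : ∀ {s u as} → as ≢ [] → 0ℤ ≤ s → 0ℤ < u →
  Run (u , s , 1ℤ) as (u , s , 1ℤ) → SqrtCF (s * s + u) (periodicCF s as)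
sqrtCF-of-loop {as = []} as≢[] _ _ _ = ⊥-elim (as≢[] refl)
sqrtCF-of-loop {as = y ∷ ys} _ 0≤s 0<u loop = Periodic.sqrtCF y ys 0≤s 0<u loop

-- Monotonicity and Cassini's identity for Fibonacci polynomials.

fib-mono : ∀ {m} → 0ℤ < m → ∀ j → 0ℤ ≤ fib m j × fib m j ≤ fib m (suc j)
fib-mono 0<m zero = +≤+ N.z≤n , +≤+ N.z≤n
fib-mono {m} 0<m (suc j) with fib-mono 0<m j
... | 0≤f , f≤f′ = 0≤f′ , ZP.0≤i-j⇒j≤i (subst (0ℤ ≤_) (sym (gap m (fib m (suc j)) (fib m j)))
                    (0≤+ (0≤* (ZP.i≤j⇒0≤j-i (0<⇒1≤ 0<m)) 0≤f′) 0≤f))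
  where
  0≤f′ = ZP.≤-trans 0≤f f≤f′
  gap : ∀ m f′ f → m * f′ + f - f′ ≡ (m - 1ℤ) * f′ + f
  gap = solve-∀

-- The form g² - m f g - f² changes sign under (f, g) ↦ (g, m g + f), which is one step of the
-- recurrence.
cassini : ∀ m j → fib m (suc j) * fib m (suc j) - m * fib m j * fib m (suc j) - fib m j * fib m j ≡ sgn j
cassini m zero = base m
  where
  base : ∀ m → 1ℤ * 1ℤ - m * 0ℤ * 1ℤ - 0ℤ * 0ℤ ≡ 1ℤ
  base = solve-∀
cassini m (suc j) = trans (flip m (fib m j) (fib m (suc j))) (cong -_ (cassini m j))
  where
  flip : ∀ m f g → (m * g + f) * (m * g + f) - m * g * (m * g + f) - g * g ≡ - (g * g - m * f * g - f * f)
  flip = solve-∀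

-- Explicit states and the single steps between them.

-- With lo = x_j, hi = x_{j+1} and p the mixed term between them: the states inside 𝐯 after an
-- even or odd number of steps, and the three states inside a block 1, 1, (m−2)/2 of 𝐮.  For
-- m = 2 the states uMid are joined directly by the partial quotient 2, since [a; 1, 0, 1, b]
-- contracts to [a; 2, b].
vEven vOdd uStart uMid uEnd : ℤ → ℤ → ℤ → State
vEven  lo hi p = + 4 * hi , p , lo
vOdd   lo hi p = hi , p , + 4 * lo
uStart lo hi p = hi + p - lo , p - + 2 * lo , + 4 * lo
uMid   lo hi p = lo + p - hi , hi + lo , hi + p - lo
uEnd   lo hi p = swap (uStart hi lo p)

-- The recurrence common to 𝐯, 𝐮 and 𝟐: one letter of 𝐯 or 𝟐, or one block of 𝐮, replaces (lo, hi,
-- p) by (hi, hi′, p′).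
record Link (m lo hi p hi′ p′ : ℤ) : Set where
  constructor link
  field
    hi≡ : hi′ ≡ lo + m * p - m * m * hi
    p≡  : p′ ≡ + 2 * m * hi - p

0<4* : ∀ {x} → 0ℤ < x → 0ℤ < + 4 * x
0<4* = 0<* {+ 4} 0<pos

module _ (lo hi p : ℤ) where

  -- The quotient m/2 acting on 4 hi and the quotient 2m acting on hi both give the mixed term 2 m
  -- hi - p, so the factor 4 just alternates between the two ends.
  step-h : ∀ {h m hi′ p′} → m ≡ + 2 * h → 1ℤ ≤ h → 0ℤ < lo → 0ℤ < hi′ →
    Link m lo hi p hi′ p′ → Step h (vEven lo hi p) (vOdd hi hi′ p′)
  step-h {h} refl 1≤h 0<lo 0<hi′ (link refl refl) =
    step 1≤h 0<lo 0<hi′ (state≡ (e₁ h lo hi p) (e₂ h hi p) refl)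
    where
    e₁ : ∀ h lo hi p → + 2 * p * h + lo - + 4 * hi * (h * h) ≡ lo + + 2 * h * p - + 2 * h * (+ 2 * h) * hi
    e₁ = solve-∀
    e₂ : ∀ h hi p → h * (+ 4 * hi) - p ≡ + 2 * (+ 2 * h) * hi - p
    e₂ = solve-∀

  step-2m : ∀ {m hi′ p′} → 0ℤ < m → 0ℤ < lo → 0ℤ < hi′ →
    Link m lo hi p hi′ p′ → Step (+ 2 * m) (vOdd lo hi p) (vEven hi hi′ p′)
  step-2m {m} 0<m 0<lo 0<hi′ (link refl refl) =
    step (0<⇒1≤ (0<* {+ 2} 0<pos 0<m)) (0<4* 0<lo) (0<4* 0<hi′) (state≡ (e₁ m lo hi p) refl refl)
    where
    e₁ : ∀ m lo hi p → + 2 * p * (+ 2 * m) + + 4 * lo - hi * (+ 2 * m * (+ 2 * m)) ≡ + 4 * (lo + m * p - m * m * hi)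
    e₁ = solve-∀

  step-1ˢ : 0ℤ < lo → 0ℤ < lo + p - hi → Step 1ℤ (uStart lo hi p) (uMid lo hi p)
  step-1ˢ 0<lo 0<u = step ZP.≤-refl (0<4* 0<lo) 0<u (state≡ (e₁ lo hi p) (e₂ lo hi p) refl)
    where
    e₁ : ∀ lo hi p → + 2 * (p - + 2 * lo) * 1ℤ + + 4 * lo - (hi + p - lo) * (1ℤ * 1ℤ) ≡ lo + p - hi
    e₁ = solve-∀
    e₂ : ∀ lo hi p → 1ℤ * (hi + p - lo) - (p - + 2 * lo) ≡ hi + lo
    e₂ = solve-∀

  step-1ᵉ : 0ℤ < hi + p - lo → 0ℤ < hi → Step 1ℤ (uMid lo hi p) (uEnd lo hi p)
  step-1ᵉ 0<w 0<hi = step ZP.≤-refl 0<w (0<4* 0<hi) (state≡ (e₁ lo hi p) (e₂ lo hi p) refl)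
    where
    e₁ : ∀ lo hi p → + 2 * (hi + lo) * 1ℤ + (hi + p - lo) - (lo + p - hi) * (1ℤ * 1ℤ) ≡ + 4 * hi
    e₁ = solve-∀
    e₂ : ∀ lo hi p → 1ℤ * (lo + p - hi) - (hi + lo) ≡ p - + 2 * hi
    e₂ = solve-∀

  step-u : ∀ {h m hi′ p′} → m ≡ + 2 * h + + 2 → 1ℤ ≤ h → 0ℤ < lo + p - hi → 0ℤ < hi′ + p′ - hi →
    Link m lo hi p hi′ p′ → Step h (uEnd lo hi p) (uStart hi hi′ p′)
  step-u {h} refl 1≤h 0<w 0<u (link refl refl) = step 1≤h 0<w 0<u (state≡ (e₁ h lo hi p) (e₂ h hi p) refl)
    where
    e₁ : ∀ h lo hi p → let m = + 2 * h + + 2 in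
      + 2 * (p - + 2 * hi) * h + (lo + p - hi) - + 4 * hi * (h * h)
      ≡ (lo + m * p - m * m * hi) + (+ 2 * m * hi - p) - hi
    e₁ = solve-∀
    e₂ : ∀ h hi p → h * (+ 4 * hi) - (p - + 2 * hi) ≡ + 2 * (+ 2 * h + + 2) * hi - p - + 2 * hi
    e₂ = solve-∀

  -- For m = 2 the recurrence gives hi′ + p′ = lo + p, so the last entry of the target is the first
  -- entry of the source, as `next` demands.
  step-2 : ∀ {m hi′ p′} → m ≡ + 2 → 0ℤ < hi + p - lo → 0ℤ < hi + p′ - hi′ →
    Link m lo hi p hi′ p′ → Step (+ 2) (uMid lo hi p) (uMid hi hi′ p′)
  step-2 refl 0<w 0<u (link refl refl) =
    step 1≤pos 0<w 0<u (state≡ (e₁ lo hi p) (e₂ lo hi p) (e₃ lo hi p))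
    where
    e₁ : ∀ lo hi p → + 2 * (hi + lo) * + 2 + (hi + p - lo) - (lo + p - hi) * (+ 2 * + 2)
      ≡ hi + (+ 2 * + 2 * hi - p) - (lo + + 2 * p - + 2 * + 2 * hi)
    e₁ = solve-∀
    e₂ : ∀ lo hi p → + 2 * (lo + p - hi) - (hi + lo) ≡ lo + + 2 * p - + 2 * + 2 * hi + hi
    e₂ = solve-∀
    e₃ : ∀ lo hi p → lo + p - hi ≡ lo + + 2 * p - + 2 * + 2 * hi + (+ 2 * + 2 * hi - p) - hi
    e₃ = solve-∀

-- Halving and parity.

pred-suc : ∀ y → y + 1ℤ - 1ℤ ≡ y
pred-suc = solve-∀

even-half : ∀ {c} → 1ℤ ≤ c → (+ 2 * c) /ℕ 2 ≡ c
even-half {+[1+ n ]} _ = cong +_ (trans (cong (ND._/ 2) (NP.*-comm 2 (suc n))) (ND.m*n/n≡m (suc n) 2))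
even-half {+ zero} (+≤+ ())

half≥1 : ∀ {c} → 0ℤ < + 2 * c → 1ℤ ≤ c
half≥1 0<2c = 0<⇒1≤ (ZP.*-cancelˡ-<-nonNeg (+ 2) 0<2c)

fib-parity : ∀ h j → EvenZ (fib (+ 2 * h) (j N.* 2)) × OddZ (fib (+ 2 * h) (suc (j N.* 2)))
fib-parity h zero = (0ℤ , refl) , (0ℤ , refl)
fib-parity h (suc j) with fib-parity h j
... | (a , fa) , (b , fb) =
  even , (h * (+ 2 * proj₁ even) + b , trans (cong₂ (λ y z → + 2 * h * y + z) (proj₂ even) fb) (r₂ h (proj₁ even) b))
  where
  r₁ : ∀ h a b → + 2 * h * (+ 2 * b + 1ℤ) + + 2 * a ≡ + 2 * (h * (+ 2 * b + 1ℤ) + a)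
  r₁ = solve-∀
  r₂ : ∀ h e b → + 2 * h * (+ 2 * e) + (+ 2 * b + 1ℤ) ≡ + 2 * (h * (+ 2 * e) + b) + 1ℤ
  r₂ = solve-∀
  even : EvenZ (fib (+ 2 * h) (suc j N.* 2))
  even = h * (+ 2 * b + 1ℤ) + a , trans (cong₂ (λ y z → + 2 * h * y + z) fb fa) (r₁ h a b)

-- The states in terms of Fibonacci polynomials, and the runs along 𝐯, 𝐮 and 𝟐.

module Family (m κ : ℤ) (0<m : 0ℤ < m) (0<κ : 0ℤ < κ) where

  f : ℕ → ℤ
  f = fib m

  -- Two indices with j + r = n avoid subtraction: `x j (suc r)` and `x (suc j) r` are x_j and
  -- x_{j+1}, and `tr 0 n` is s.
  x tr : ℕ → ℕ → ℤ
  x  j r = κ * (f j * f r) + 1ℤ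
  tr j r = κ * (f (suc j) * f (suc r) - f j * f r) + m

  -- j counts the letters of 𝐯 (or of 𝟐, or the blocks of 𝐮) already read, r those still to come.
  at : (ℤ → ℤ → ℤ → State) → ℕ → ℕ → State
  at φ j r = φ (x j (suc r)) (x (suc j) r) (tr j r)

  x-comm : ∀ j r → x j r ≡ x r j
  x-comm j r = cong (λ y → κ * y + 1ℤ) (ZP.*-comm (f j) (f r))

  tr-comm : ∀ j r → tr j r ≡ tr r j
  tr-comm j r = cong₂ (λ y z → κ * (y - z) + m) (ZP.*-comm (f (suc j)) (f (suc r))) (ZP.*-comm (f j) (f r))

  at-comm : ∀ φ j r → at φ j r ≡ at (λ lo hi p → φ hi lo p) r j
  at-comm φ j r rewrite x-comm j (suc r) | x-comm (suc j) r | tr-comm j r = refl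

  -- Only the Fibonacci recurrence enters, unfolded once in j and once in r; after that f_j,
  -- f_{j+1}, f_r, f_{r+1} are free variables.
  link-at : ∀ j r →
    Link m (x j (suc (suc r))) (x (suc j) (suc r)) (tr j (suc r)) (x (suc (suc j)) r) (tr (suc j) r)
  link-at j r = link (e₁ m κ (f (suc j)) (f j) (f (suc r)) (f r)) (e₂ m κ (f (suc j)) (f j) (f (suc r)) (f r))
    where
    e₁ : ∀ m κ a b c e → κ * ((m * a + b) * e) + 1ℤ
      ≡ (κ * (b * (m * c + e)) + 1ℤ) + m * (κ * (a * (m * c + e) - b * c) + m) - m * m * (κ * (a * c) + 1ℤ)
    e₁ = solve-∀
    e₂ : ∀ m κ a b c e → κ * ((m * a + b) * c - a * e) + m
      ≡ + 2 * m * (κ * (a * c) + 1ℤ) - (κ * (a * (m * c + e) - b * c) + m)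
    e₂ = solve-∀

  0≤f : ∀ j → 0ℤ ≤ f j
  0≤f j = proj₁ (fib-mono 0<m j)

  0≤Δf : ∀ j → 0ℤ ≤ f (suc j) - f j
  0≤Δf j = ZP.i≤j⇒0≤j-i (proj₂ (fib-mono 0<m j))

  0≤κ : 0ℤ ≤ κ
  0≤κ = ZP.<⇒≤ 0<κ

  0<x : ∀ j r → 0ℤ < x j r
  0<x j r = 0≤+< (0≤* 0≤κ (0≤* (0≤f j) (0≤f r))) 0<pos

  -- The expression factors as κ (f_{j+1} + f_j) (f_{r+1} - f_r) + m, and monotonicity makes the
  -- product nonnegative.
  0<lo+tr-hi : ∀ j r → 0ℤ < x j (suc r) + tr j r - x (suc j) r
  0<lo+tr-hi j r = subst (0ℤ <_) (sym (e m κ (f (suc j)) (f j) (f (suc r)) (f r)))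
    (0≤+< (0≤* 0≤κ (0≤* (0≤+ (0≤f (suc j)) (0≤f j)) (0≤Δf r))) 0<m)
    where
    e : ∀ m κ a b c e → (κ * (b * c) + 1ℤ) + (κ * (a * c - b * e) + m) - (κ * (a * e) + 1ℤ)
      ≡ κ * ((a + b) * (c - e)) + m
    e = solve-∀

  0<hi+tr-lo : ∀ j r → 0ℤ < x (suc j) r + tr j r - x j (suc r)
  0<hi+tr-lo j r = subst (0ℤ <_)
    (sym (trans (cong₂ (λ y z → y + tr j r - z) (x-comm (suc j) r) (x-comm j (suc r)))
      (cong (λ t → x r (suc j) + t - x (suc r) j) (tr-comm j r))))
    (0<lo+tr-hi r j)

  run-v : ∀ {h} → m ≡ + 2 * h → 1ℤ ≤ h → ∀ q j →
    Run (at vEven j (q N.* 2)) (rep q (h ∷ + 2 * m ∷ [])) (at vEven (q N.* 2 N.+ j) 0)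
  run-v m≡2h 1≤h zero j = []
  run-v {h} m≡2h 1≤h (suc q) j =
    step-h (x j (suc (suc r))) (x (suc j) (suc r)) (tr j (suc r)) m≡2h 1≤h
      (0<x j (suc (suc r))) (0<x (suc (suc j)) r) (link-at j r)
    ∷ step-2m (x (suc j) (suc r)) (x (suc (suc j)) r) (tr (suc j) r) 0<m
        (0<x (suc j) (suc r)) (0<x (suc (suc (suc j))) (q N.* 2)) (link-at (suc j) (q N.* 2))
    ∷ subst (λ i → Run (at vEven (suc (suc j)) (q N.* 2)) (rep q (h ∷ + 2 * m ∷ [])) (at vEven i 0))
        shift (run-v m≡2h 1≤h q (suc (suc j)))
    where
    r = suc (q N.* 2)
    shift : q N.* 2 N.+ suc (suc j) ≡ suc (suc (q N.* 2 N.+ j))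
    shift = trans (NP.+-suc (q N.* 2) (suc j)) (cong suc (NP.+-suc (q N.* 2) j))

  run-u : ∀ {h} → m ≡ + 2 * h + + 2 → 1ℤ ≤ h → ∀ r j →
    Run (at uStart j r) (rep r (1ℤ ∷ 1ℤ ∷ h ∷ [])) (at uStart (r N.+ j) 0)
  run-u m≡2h+2 1≤h zero j = []
  run-u {h} m≡2h+2 1≤h (suc r) j =
    step-1ˢ (x j (suc (suc r))) (x (suc j) (suc r)) (tr j (suc r)) (0<x j (suc (suc r))) (0<lo+tr-hi j (suc r))
    ∷ step-1ᵉ (x j (suc (suc r))) (x (suc j) (suc r)) (tr j (suc r)) (0<hi+tr-lo j (suc r)) (0<x (suc j) (suc r))
    ∷ step-u (x j (suc (suc r))) (x (suc j) (suc r)) (tr j (suc r)) m≡2h+2 1≤h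
        (0<lo+tr-hi j (suc r)) (0<hi+tr-lo (suc j) r) (link-at j r)
    ∷ subst (λ i → Run (at uStart (suc j) r) (rep r (1ℤ ∷ 1ℤ ∷ h ∷ [])) (at uStart i 0))
        (NP.+-suc r j) (run-u m≡2h+2 1≤h r (suc j))

  run-2 : m ≡ + 2 → ∀ r j → Run (at uMid j r) (rep r [ + 2 ]) (at uMid (r N.+ j) 0)
  run-2 m≡2 zero j = []
  run-2 m≡2 (suc r) j =
    step-2 (x j (suc (suc r))) (x (suc j) (suc r)) (tr j (suc r))
      m≡2 (0<hi+tr-lo j (suc r)) (0<lo+tr-hi (suc j) r) (link-at j r)
    ∷ subst (λ i → Run (at uMid (suc j) r) (rep r [ + 2 ]) (at uMid i 0)) (NP.+-suc r j) (run-2 m≡2 r (suc j))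

  -- Assembling the palindromic period around its middle word.

  module Palindrome {h : ℤ} (m≡2h : m ≡ + 2 * h) (1≤h : 1ℤ ≤ h) (q n : ℕ) (n≡2q : n ≡ q N.* 2) where

    v : List ℤ
    v = rep q (h ∷ + 2 * m ∷ [])

    s : ℤ
    s = tr 0 n

    m≤s : m ≤ s
    m≤s = subst (_≤ s) (ZP.+-identityˡ m)
      (ZP.+-monoˡ-≤ m (0≤* 0≤κ (subst (0ℤ ≤_) (e (f (suc n)) (f n)) (0≤f (suc n)))))
      where
      e : ∀ a b → a ≡ 1ℤ * a - 0ℤ * b
      e = solve-∀

    0<s : 0ℤ < s
    0<s = ZP.<-≤-trans 0<m m≤s

    -- Follows from m ≥ 2, and ensures (s - 1)/2 ≥ 1 when s is odd.
    1<s : 1ℤ < s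
    1<s = ZP.<-≤-trans (ZP.<-≤-trans (+<+ (N.s≤s (N.s≤s N.z≤n)))
      (subst (+ 2 ≤_) (sym m≡2h) (ZP.*-monoˡ-≤-nonNeg (+ 2) 1≤h))) m≤s

    start middle : State
    start  = + 4 * x 1 n , s , 1ℤ
    middle = + 4 , s , x 1 n

    lo≡1 : x 0 (suc n) ≡ 1ℤ
    lo≡1 = e κ (f (suc n))
      where
      e : ∀ κ g → κ * (0ℤ * g) + 1ℤ ≡ 1ℤ
      e = solve-∀

    -- The symmetry between j and r makes the final state the initial one with lo and hi exchanged;
    -- n + 0 is the counter left by a run started at j = 0.
    at-end : ∀ φ → at φ (n N.+ 0) 0 ≡ φ (x 1 n) 1ℤ s
    at-end φ = trans (cong (λ i → at φ i 0) (NP.+-identityʳ n))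
      (trans (at-comm φ n 0) (cong (λ y → φ (x 1 n) y s) lo≡1))

    at-start : ∀ φ → at φ 0 n ≡ φ 1ℤ (x 1 n) s
    at-start φ = cong (λ y → φ y (x 1 n) s) lo≡1

    leg : Run start v middle
    leg = subst₂ (λ S T → Run S v T) (at-start vEven) (at-end vEven)
      (subst (λ i → Run (at vEven 0 i) v (at vEven (i N.+ 0) 0)) (sym n≡2q) (run-v m≡2h 1≤h q 0))

    last-step : Step (+ 2 * s) (swap start) start
    last-step = step (0<⇒1≤ (0<* {+ 2} 0<pos 0<s)) (0<4* (0<x 1 n)) (0<4* (0<x 1 n))
      (state≡ (e₁ s (x 1 n)) (e₂ s) refl)
      where
      e₁ : ∀ s y → + 2 * s * (+ 2 * s) + + 4 * y - 1ℤ * (+ 2 * s * (+ 2 * s)) ≡ + 4 * y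
      e₁ = solve-∀
      e₂ : ∀ s → + 2 * s * 1ℤ - s ≡ s
      e₂ = solve-∀

    -- Once w has led from `middle` to its mirror image, the reversed `leg` reaches `swap start`,
    -- and the quotient 2s returns to `start`.
    sqrtCF : ∀ {w} → w ≢ [] → Run middle w (swap middle) →
      SqrtCF (s * s + + 4 * x 1 n) (periodicCF s (v ++ w ++ reverse v ++ [ + 2 * s ]))
    sqrtCF {[]} w≢[] _ = ⊥-elim (w≢[] refl)
    sqrtCF {c ∷ w} _ run = sqrtCF-of-loop nonempty (ZP.<⇒≤ 0<s) (0<4* (0<x 1 n))
      (leg ++ᴿ run ++ᴿ run-reverse leg ++ᴿ last-step ∷ [])
      where
      nonempty : v ++ (c ∷ w) ++ reverse v ++ [ + 2 * s ] ≢ []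
      nonempty eq with ++-conicalʳ v _ eq
      ... | ()

    -- The mixed term is preserved because 4c - s = s, so this one letter is the centre of the
    -- palindrome.
    middle-even : ∀ {c} → 1ℤ ≤ c → s ≡ + 2 * c → Run middle [ c ] (swap middle)
    middle-even {c} 1≤c s≡2c = step 1≤c (0<x 1 n) (0<x 1 n) (state≡ (e₁ s≡2c) (e₂ s≡2c) refl) ∷ []
      where
      e₁ : ∀ {s} → s ≡ + 2 * c → + 2 * s * c + x 1 n - + 4 * (c * c) ≡ x 1 n
      e₁ refl = e c (x 1 n)
        where
        e : ∀ c y → + 2 * (+ 2 * c) * c + y - + 4 * (c * c) ≡ y
        e = solve-∀
      e₂ : ∀ {s} → s ≡ + 2 * c → c * + 4 - s ≡ s
      e₂ refl = e c
        where
        e : ∀ c → c * + 4 - + 2 * c ≡ + 2 * c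
        e = solve-∀

    0<hi+s-1 : 0ℤ < x 1 n + s - 1ℤ
    0<hi+s-1 = subst (λ y → 0ℤ < x 1 n + s - y) lo≡1 (0<hi+tr-lo 0 n)

    0<1+s-hi : 0ℤ < 1ℤ + s - x 1 n
    0<1+s-hi = subst (λ y → 0ℤ < y + s - x 1 n) lo≡1 (0<lo+tr-hi 0 n)

    -- Here 4c - s = s - 2, which is the mixed term at the start of the first block of 𝐮.
    step-c : ∀ {c} → 1ℤ ≤ c → s ≡ + 2 * c + 1ℤ → Step c middle (uStart 1ℤ (x 1 n) s)
    step-c {c} 1≤c s≡2c+1 = step 1≤c (0<x 1 n) 0<hi+s-1 (state≡ (e₁ s≡2c+1) (e₂ s≡2c+1) refl)
      where
      e₁ : ∀ {s} → s ≡ + 2 * c + 1ℤ → + 2 * s * c + x 1 n - + 4 * (c * c) ≡ x 1 n + s - 1ℤ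
      e₁ refl = e c (x 1 n)
        where
        e : ∀ c y → + 2 * (+ 2 * c + 1ℤ) * c + y - + 4 * (c * c) ≡ y + (+ 2 * c + 1ℤ) - 1ℤ
        e = solve-∀
      e₂ : ∀ {s} → s ≡ + 2 * c + 1ℤ → c * + 4 - s ≡ s - + 2
      e₂ refl = e c
        where
        e : ∀ c → c * + 4 - (+ 2 * c + 1ℤ) ≡ + 2 * c + 1ℤ - + 2
        e = solve-∀

    -- After the n blocks, the two extra letters 1 reach `uEnd (x 1 n) 1ℤ s`, by definition the
    -- mirror image of the state entered by the first `c`; reversing that step finishes.
    middle-odd : ∀ {c g} → 1ℤ ≤ c → s ≡ + 2 * c + 1ℤ → m ≡ + 2 * g + + 2 → 1ℤ ≤ g →
      Run middle ([ c ] ++ rep n (1ℤ ∷ 1ℤ ∷ g ∷ []) ++ 1ℤ ∷ 1ℤ ∷ c ∷ []) (swap middle)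
    middle-odd {g = g} 1≤c s≡ m≡ 1≤g = step-c 1≤c s≡ ∷
      (subst₂ (λ S T → Run S (rep n (1ℤ ∷ 1ℤ ∷ g ∷ [])) T) (at-start uStart) (at-end uStart) (run-u m≡ 1≤g n 0)
      ++ᴿ step-1ˢ (x 1 n) 1ℤ s (0<x 1 n) 0<hi+s-1
      ∷ step-1ᵉ (x 1 n) 1ℤ s 0<1+s-hi 0<pos ∷ step-swap (step-c 1≤c s≡) ∷ [])

    middle-odd-2 : ∀ {c} → 1ℤ ≤ c → s ≡ + 2 * c + 1ℤ → m ≡ + 2 →
      Run middle ([ c ] ++ [ 1ℤ ] ++ rep n [ + 2 ] ++ 1ℤ ∷ c ∷ []) (swap middle)
    middle-odd-2 1≤c s≡ m≡2 = step-c 1≤c s≡ ∷ step-1ˢ 1ℤ (x 1 n) s 0<pos 0<1+s-hi ∷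
      (subst₂ (λ S T → Run S (rep n [ + 2 ]) T) (at-start uMid) (at-end uMid) (run-2 m≡2 n 0)
      ++ᴿ step-1ᵉ (x 1 n) 1ℤ s 0<1+s-hi 0<pos ∷ step-swap (step-c 1≤c s≡) ∷ [])

    -- `D`, `S` and `l` stand for the expressions of the theorem; as variables they can be
    -- eliminated by matching on `refl`.
    sqrtCF-even : ∀ {D S l} → D ≡ s * s + + 4 * x 1 n → S ≡ s → l ≡ v → EvenZ s →
      SqrtCF D (periodicCF S (l ++ [ S /ℕ 2 ] ++ reverse l ++ [ + 2 * S ]))
    sqrtCF-even refl refl refl (c , s≡2c) =
      subst (λ y → SqrtCF (s * s + + 4 * x 1 n) (periodicCF s (v ++ [ y ] ++ reverse v ++ [ + 2 * s ])))
        (sym (trans (cong (_/ℕ 2) s≡2c) (even-half 1≤c)))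
        (sqrtCF {[ c ]} (λ ()) (middle-even 1≤c s≡2c))
      where
      1≤c : 1ℤ ≤ c
      1≤c = half≥1 (subst (0ℤ <_) s≡2c 0<s)

    module _ (s-odd : OddZ s) where

      private
        c : ℤ
        c = proj₁ s-odd

        s≡2c+1 : s ≡ + 2 * c + 1ℤ
        s≡2c+1 = proj₂ s-odd

        s-1≡2c : s - 1ℤ ≡ + 2 * c
        s-1≡2c = trans (cong (_- 1ℤ) s≡2c+1) (pred-suc (+ 2 * c))

        1≤c : 1ℤ ≤ c
        1≤c = half≥1 (subst (0ℤ <_) s-1≡2c (ZP.+-monoˡ-< (- 1ℤ) 1<s))

        c≡ : c ≡ (s - 1ℤ) /ℕ 2
        c≡ = sym (trans (cong (_/ℕ 2) s-1≡2c) (even-half 1≤c))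

      sqrtCF-odd : ∀ {D S l u g} → D ≡ s * s + + 4 * x 1 n → S ≡ s → l ≡ v →
        u ≡ rep n (1ℤ ∷ 1ℤ ∷ g ∷ []) → m ≡ + 2 * g + + 2 → 1ℤ ≤ g →
        SqrtCF D (periodicCF S (l ++ [ (S - 1ℤ) /ℕ 2 ] ++ u ++ (1ℤ ∷ 1ℤ ∷ (S - 1ℤ) /ℕ 2 ∷ [])
          ++ reverse l ++ [ + 2 * S ]))
      sqrtCF-odd {u = u} refl refl refl refl m≡ 1≤g =
        subst (λ y → SqrtCF (s * s + + 4 * x 1 n)
            (periodicCF s (v ++ [ y ] ++ u ++ (1ℤ ∷ 1ℤ ∷ y ∷ []) ++ reverse v ++ [ + 2 * s ]))) c≡
          (subst (λ l → SqrtCF (s * s + + 4 * x 1 n) (periodicCF s (v ++ c ∷ l)))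
            (++-assoc u (1ℤ ∷ 1ℤ ∷ c ∷ []) (reverse v ++ [ + 2 * s ]))
            (sqrtCF {[ c ] ++ u ++ 1ℤ ∷ 1ℤ ∷ c ∷ []} (λ ()) (middle-odd 1≤c s≡2c+1 m≡ 1≤g)))

      sqrtCF-odd-2 : ∀ {D S l} → D ≡ s * s + + 4 * x 1 n → S ≡ s → l ≡ v → m ≡ + 2 →
        SqrtCF D (periodicCF S (l ++ [ (S - 1ℤ) /ℕ 2 ] ++ [ 1ℤ ] ++ rep n [ + 2 ] ++ (1ℤ ∷ (S - 1ℤ) /ℕ 2 ∷ [])
          ++ reverse l ++ [ + 2 * S ]))
      sqrtCF-odd-2 refl refl refl m≡2 =
        subst (λ y → SqrtCF (s * s + + 4 * x 1 n)
            (periodicCF s (v ++ [ y ] ++ [ 1ℤ ] ++ rep n [ + 2 ] ++ (1ℤ ∷ y ∷ []) ++ reverse v ++ [ + 2 * s ]))) c≡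
          (subst (λ l → SqrtCF (s * s + + 4 * x 1 n) (periodicCF s (v ++ c ∷ 1ℤ ∷ l)))
            (++-assoc (rep n [ + 2 ]) (1ℤ ∷ c ∷ []) (reverse v ++ [ + 2 * s ]))
            (sqrtCF {[ c ] ++ [ 1ℤ ] ++ rep n [ + 2 ] ++ 1ℤ ∷ c ∷ []} (λ ()) (middle-odd-2 1≤c s≡2c+1 m≡2)))

-- Identifying s, t and D of the theorem with the family.

-- The expression is `tr 0 n` unfolded with κ = k + F; since F and m are even and f_{n+1} is odd, it
-- has the parity of k.
tr-even : ∀ {k F f m} y → EvenZ k → EvenZ F → OddZ f → EvenZ m → EvenZ ((k + F) * (1ℤ * f - 0ℤ * y) + m)
tr-even y (i , refl) (a , refl) (b , refl) (h , refl) = (i + a) * (+ 2 * b + 1ℤ) + h , e i a b h y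
  where
  e : ∀ i a b h y → (+ 2 * i + + 2 * a) * (1ℤ * (+ 2 * b + 1ℤ) - 0ℤ * y) + + 2 * h
    ≡ + 2 * ((i + a) * (+ 2 * b + 1ℤ) + h)
  e = solve-∀

tr-odd : ∀ {k F f m} y → OddZ k → EvenZ F → OddZ f → EvenZ m → OddZ ((k + F) * (1ℤ * f - 0ℤ * y) + m)
tr-odd y (i , refl) (a , refl) (b , refl) (h , refl) = (+ 2 * b + 1ℤ) * (i + a) + b + h , e i a b h y
  where
  e : ∀ i a b h y → (+ 2 * i + 1ℤ + + 2 * a) * (1ℤ * (+ 2 * b + 1ℤ) - 0ℤ * y) + + 2 * h
    ≡ + 2 * ((+ 2 * b + 1ℤ) * (i + a) + b + h) + 1ℤ
  e = solve-∀

-- f_n f_{n-1} - f_{n-2} f_{n+1} is m times the Cassini form at n - 2, whose value is 1 because n is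
-- even.
sS-formula : ∀ m n k q → n ≡ suc q N.* 2 → let f = fib (+ m) in
  sS m n k ≡ (k + f (q N.* 2)) * (1ℤ * f (suc n) - 0ℤ * f n) + + m
sS-formula m _ k q refl =
  trans (cong (λ σ → σ * f (suc (suc N)) * f (suc N) + k * f (suc (suc (suc N)))) (sgn-even (suc q)))
    (trans (e (+ m) k (f N) (f (suc N))) (cong (λ y → (k + f N) * (1ℤ * f (suc (suc (suc N))) - 0ℤ * f (suc (suc N))) + y)
      (trans (cong (+ m *_) (trans (cassini (+ m) N) (sgn-even q))) (ZP.*-identityʳ (+ m)))))
  where
  N = q N.* 2
  f = fib (+ m)
  e : ∀ m k F G → let fₙ = m * G + F; fₙ₊₁ = m * fₙ + G in
    1ℤ * fₙ * G + k * fₙ₊₁ ≡ (k + F) * (1ℤ * fₙ₊₁ - 0ℤ * fₙ) + m * (G * G - m * F * G - F * F)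
  e = solve-∀

-- f_{n-1}² - f_{n-2} f_n is the Cassini form itself; the result is x_1, whence D = s² + 4 x_1.
-tT-formula : ∀ m n k q → n ≡ suc q N.* 2 → let f = fib (+ m) in
  - tT m n k ≡ (k + f (q N.* 2)) * (1ℤ * f n) + 1ℤ
-tT-formula m _ k q refl =
  trans (cong (λ σ → - (- σ * (f (suc N) * f (suc N)) - k * f (suc (suc N)))) (sgn-even q))
    (trans (e (+ m) k (f N) (f (suc N))) (cong (λ c → (k + f N) * (1ℤ * f (suc (suc N))) + c)
      (trans (cassini (+ m) N) (sgn-even q))))
  where
  N = q N.* 2
  f = fib (+ m)
  e : ∀ m k F G → let fₙ = m * G + F in
    - (- 1ℤ * (G * G) - k * fₙ) ≡ (k + F) * (1ℤ * fₙ) + (G * G - m * F * G - F * F)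
  e = solve-∀

DD-formula : ∀ s t {s′ y} → s ≡ s′ → - t ≡ y → s * s - + 4 * t ≡ s′ * s′ + + 4 * y
DD-formula s t refl refl = e s t
  where
  e : ∀ s t → s * s - + 4 * t ≡ s * s + + 4 * - t
  e = solve-∀

theorem3p5 : (m n : ℕ) (k : ℤ) → 2 ∣ m → 0 N.< m → 2 ∣ n → 0 N.< n →
    sgn (n ∸ 1) * fib (+ m) (n ∸ 2) + 1ℤ ≤ k →
    (EvenZ k → SqrtCF (DD m n k) (periodicCF (sS m n k) (period1 m n k)))
    × (OddZ k → 2 N.< m → SqrtCF (DD m n k) (periodicCF (sS m n k) (period2 m n k)))
    × (OddZ k → m ≡ 2 → SqrtCF (DD m n k) (periodicCF (sS m n k) (period3 m n k)))
theorem3p5 _ _ _ (divides zero refl) () _ _ _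
theorem3p5 _ _ _ _ _ (divides zero refl) () _
-- From here on g = (m - 2)/2 and q = (n - 2)/2.
theorem3p5 m n k (divides (suc g) m≡) 0<m (divides (suc q) n≡) _ bound =
  (λ k-even → sqrtCF-even DD≡ s≡ v≡ (tr-even (fib (+ m) n) k-even F-even fₙ₊₁-odd (+[1+ g ] , m≡2h))) ,
  (λ k-odd 2<m → sqrtCF-odd (s-odd k-odd) DD≡ s≡ v≡ u≡ m≡2g+2 (1≤g g (subst (2 N.<_) m≡ 2<m))) ,
  (λ k-odd m≡2 → sqrtCF-odd-2 (s-odd k-odd) DD≡ s≡ v≡ (cong +_ m≡2))
  where
  F κ : ℤ
  F = fib (+ m) (q N.* 2)
  κ = k + F

  m≡2h : + m ≡ + 2 * +[1+ g ]
  m≡2h = cong +_ (trans m≡ (NP.*-comm (suc g) 2))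

  m≡2g+2 : + m ≡ + 2 * + g + + 2
  m≡2g+2 = trans (cong +_ (trans m≡ (trans (NP.+-comm 2 (g N.* 2)) (cong (N._+ 2) (NP.*-comm g 2)))))
    (cong (_+ + 2) (ZP.pos-* 2 g))

  -- The letter (m - 2)/2 is zero at m = 2, which is why that case has its own period.
  1≤g : ∀ g → 2 N.< suc g N.* 2 → 1ℤ ≤ + g
  1≤g zero (N.s≤s (N.s≤s ()))
  1≤g (suc g) _ = 1≤pos

  -- As n - 1 is odd, the bound on k reads 1 - f_{n-2} ≤ k.
  1≤κ : 1ℤ ≤ κ
  1≤κ = subst (_≤ κ) (trans (cong (λ σ → - σ * F + 1ℤ + F) (sgn-even q)) (cancel F))
    (ZP.+-monoˡ-≤ F (subst (λ i → sgn (i ∸ 1) * fib (+ m) (i ∸ 2) + 1ℤ ≤ k) n≡ bound))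
    where
    cancel : ∀ F → - 1ℤ * F + 1ℤ + F ≡ 1ℤ
    cancel = solve-∀

  open Family (+ m) κ (+<+ 0<m) (1≤⇒0< 1≤κ)
  open Palindrome m≡2h 1≤pos (suc q) n n≡

  F-even : EvenZ F
  F-even = subst (λ μ → EvenZ (fib μ (q N.* 2))) (sym m≡2h) (proj₁ (fib-parity +[1+ g ] q))

  fₙ₊₁-odd : OddZ (fib (+ m) (suc n))
  fₙ₊₁-odd = subst₂ (λ μ i → OddZ (fib μ (suc i))) (sym m≡2h) (sym n≡) (proj₂ (fib-parity +[1+ g ] (suc q)))

  s-odd : OddZ k → OddZ s
  s-odd k-odd = tr-odd (fib (+ m) n) k-odd F-even fₙ₊₁-odd (+[1+ g ] , m≡2h)

  s≡ : sS m n k ≡ s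
  s≡ = sS-formula m n k q n≡

  DD≡ : DD m n k ≡ s * s + + 4 * x 1 n
  DD≡ = DD-formula (sS m n k) (tT m n k) s≡ (-tT-formula m n k q n≡)

  v≡ : vv m n k ≡ v
  v≡ = cong₂ rep (trans (cong (ND._/ 2) n≡) (ND.m*n/n≡m (suc q) 2))
    (cong₂ (λ y z → + y ∷ z ∷ []) (trans (cong (ND._/ 2) m≡) (ND.m*n/n≡m (suc g) 2)) (ZP.pos-* 2 m))

  u≡ : uu m n k ≡ rep n (1ℤ ∷ 1ℤ ∷ + g ∷ [])
  u≡ = cong (λ y → rep n (1ℤ ∷ 1ℤ ∷ + y ∷ [])) (trans (cong (λ i → (i ∸ 2) ND./ 2) m≡) (ND.m*n/n≡m g 2))
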